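{- The variety of Łukasiewicz near semirings is arithmetical (that is, every Łukasiewicz near semiring is both congruence permutable and congruence distributive), with witness Mal'cev term $$p(x,y,z)=\alpha\Big(\big(\alpha(x\cdot\alpha(y))\cdot\alpha(z)\big)+\big(\alpha(z\cdot\alpha(y))\cdot\alpha(x)\big)\Big).$$
   Context: A near semiring is an algebra $\langle R,+,\cdot,0,1\rangle$ such that: (i) $\langle R,+,0\rangle$ is a commutative monoid; (ii) $x\cdot 1=x=1\cdot x$ (multiplication need not be associative or commutative); (iii) $(x+y)\cdot z=(x\cdot z)+(y\cdot z)$; (iv) $x\cdot 0=0\cdot x=0$. It is idempotent if $x+x=x$; then $x\le y$ iff $x+y=y$ defines a partial order, called the induced order. An involutive near semiring is an idempotent near semiring with a map $\alpha:R\to R$ such that $\alpha(\alpha(x))=x$, and $x\le y$ implies $\alpha(y)\le\alpha(x)$. A Łukasiewicz near semiring is an involutive near semiring satisfying the identity $\alpha(x\cdot\alpha(y))\cdot\alpha(y)=\alpha(y\cdot\alpha(x))\cdot\alpha(x)$. An algebra is congruence permutable if $\theta\circ\phi=\phi\circ\theta$ for all its congruences $\theta,\phi$; it is congruence distributive if its lattice of congruences is distributive; it is arithmetical if it is both. A variety is arithmetical if all its members are. A Mal'cev term for a variety is a ternary term $p$ such that $p(x,x,y)=y$ and $p(x,y,y)=x$ hold in the variety. Congruences are with respect to all operations $+,\cdot,\alpha,0,1$. -}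

module Defs where

open import Level using (Level; _⊔_; suc)
open import Algebra.Core using (Op₁; Op₂)
open import Data.Fin.Base using (Fin)
open import Data.Fin.Patterns using (0F; 1F; 2F)
open import Data.Nat.Base using (ℕ)
open import Data.Product.Base using (_×_; _,_; proj₁; proj₂)
open import Data.Sum.Base using (inj₁; inj₂)
open import Data.Vec.Functional using (Vector; []; _∷_)
open import Function.Base using (id)
open import Relation.Binary.Core using (Rel; _⇒_; _⇔_)
open import Relation.Binary.Structures using (IsEquivalence)
open import Relation.Binary.Construct.Closure.ReflexiveTransitive
  using (Star; ε; _◅_; _◅◅_; gmap; fold; reverse)
open import Relation.Binary.Construct.Composition using (_;_)
open import Relation.Binary.Construct.Intersection using (_∩_)
open import Relation.Binary.Construct.Union using (_∪_)
open import Relation.Binary.Lattice.Bundles using (Lattice)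
open import Relation.Binary.Lattice.Structures using (IsDistributiveLattice)
import Algebra.Definitions
import Algebra.Structures

-- Algebras are setoid-based: _≈_ plays the role of equality.
record RawAlgebra c ℓ : Set (suc (c ⊔ ℓ)) where
  infix  4 _≈_ _≤_
  infixl 7 _·_
  infixl 6 _+_
  field
    Carrier : Set c
    _≈_     : Rel Carrier ℓ
    _+_     : Op₂ Carrier
    _·_     : Op₂ Carrier
    α       : Op₁ Carrier
    0#      : Carrier
    1#      : Carrier

  _≤_ : Rel Carrier ℓ
  x ≤ y = x + y ≈ y

-- Unlike the standard library's near-semirings, multiplication here is unital
-- but not assumed associative.
record IsNearSemiring {c ℓ} (A : RawAlgebra c ℓ) : Set (c ⊔ ℓ) where
  open RawAlgebra A
  open Algebra.Definitions _≈_
  open Algebra.Structures _≈_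
  field
    +-isCommutativeMonoid : IsCommutativeMonoid _+_ 0#
    ·-cong                : Congruent₂ _·_
    ·-identity            : Identity 1# _·_
    distribʳ              : _·_ DistributesOverʳ _+_
    zero                  : Zero 0# _·_

record IsIdempotentNearSemiring {c ℓ} (A : RawAlgebra c ℓ) : Set (c ⊔ ℓ) where
  open RawAlgebra A
  open Algebra.Definitions _≈_
  field
    isNearSemiring : IsNearSemiring A
    +-idem         : Idempotent _+_

  open IsNearSemiring isNearSemiring public

record IsInvolutiveNearSemiring {c ℓ} (A : RawAlgebra c ℓ) : Set (c ⊔ ℓ) where
  open RawAlgebra A
  open Algebra.Definitions _≈_
  field
    isIdempotentNearSemiring : IsIdempotentNearSemiring A
    α-cong                   : Congruent₁ α
    α-involutive             : Involutive α
    α-antitone               : ∀ {x y} → x ≤ y → α y ≤ α x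

  open IsIdempotentNearSemiring isIdempotentNearSemiring public

record IsŁukasiewiczNearSemiring {c ℓ} (A : RawAlgebra c ℓ) : Set (c ⊔ ℓ) where
  open RawAlgebra A
  field
    isInvolutiveNearSemiring : IsInvolutiveNearSemiring A
    łukasiewicz : ∀ x y → α (x · α y) · α y ≈ α (y · α x) · α x

  open IsInvolutiveNearSemiring isInvolutiveNearSemiring public

infixl 7 _·ᵗ_
infixl 6 _+ᵗ_

data Term (n : ℕ) : Set where
  var   : Fin n → Term n
  _+ᵗ_  : Term n → Term n → Term n
  _·ᵗ_  : Term n → Term n → Term n
  αᵗ    : Term n → Term n
  0ᵗ 1ᵗ : Term n

module _ {c ℓ} (A : RawAlgebra c ℓ) where
  open RawAlgebra A

  eval : ∀ {n} → Term n → Vector Carrier n → Carrier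
  eval (var i)  ρ = ρ i
  eval (s +ᵗ t) ρ = eval s ρ + eval t ρ
  eval (s ·ᵗ t) ρ = eval s ρ · eval t ρ
  eval (αᵗ t)   ρ = α (eval t ρ)
  eval 0ᵗ       ρ = 0#
  eval 1ᵗ       ρ = 1#

  -- The constants impose no compatibility condition beyond reflexivity.
  record Congruence k : Set (c ⊔ ℓ ⊔ suc k) where
    field
      rel           : Rel Carrier k
      isEquivalence : IsEquivalence rel
      from-≈        : _≈_ ⇒ rel
      +-compat      : ∀ {x x′ y y′} → rel x x′ → rel y y′ → rel (x + y) (x′ + y′)
      ·-compat      : ∀ {x x′ y y′} → rel x x′ → rel y y′ → rel (x · y) (x′ · y′)
      α-compat      : ∀ {x x′} → rel x x′ → rel (α x) (α x′)

    open IsEquivalence isEquivalence public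

module _ {c ℓ} {A : RawAlgebra c ℓ} where
  open RawAlgebra A
  open Congruence

  infixr 7 _∧_
  infixr 6 _∨_

  _∧_ : ∀ {k} → Congruence A k → Congruence A k → Congruence A k
  θ ∧ φ = record
    { rel           = rel θ ∩ rel φ
    ; isEquivalence = record
      { refl  = refl θ , refl φ
      ; sym   = λ (p , q) → sym θ p , sym φ q
      ; trans = λ (p , q) (p′ , q′) → trans θ p p′ , trans φ q q′
      }
    ; from-≈   = λ e → from-≈ θ e , from-≈ φ e
    ; +-compat = λ (p , q) (p′ , q′) → +-compat θ p p′ , +-compat φ q q′
    ; ·-compat = λ (p , q) (p′ , q′) → ·-compat θ p p′ , ·-compat φ q q′
    ; α-compat = λ (p , q) → α-compat θ p , α-compat φ q
    }

  -- The transitive closure of the union; its level is raised by that of the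
  -- carrier, since paths pass through intermediate elements.
  _∨_ : ∀ {k} → Congruence A k → Congruence A k → Congruence A (c ⊔ k)
  θ ∨ φ = record
    { rel           = Star R
    ; isEquivalence = record
      { refl  = ε
      ; sym   = reverse λ { (inj₁ p) → inj₁ (sym θ p) ; (inj₂ q) → inj₂ (sym φ q) }
      ; trans = _◅◅_
      }
    ; from-≈   = λ e → inj₁ (from-≈ θ e) ◅ ε
    ; +-compat = λ {_} {x′} {y} ps qs →
        gmap (_+ y) (λ { (inj₁ p) → inj₁ (+-compat θ p (refl θ))
                       ; (inj₂ p) → inj₂ (+-compat φ p (refl φ)) }) ps
        ◅◅
        gmap (x′ +_) (λ { (inj₁ q) → inj₁ (+-compat θ (refl θ) q)
                        ; (inj₂ q) → inj₂ (+-compat φ (refl φ) q) }) qs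
    ; ·-compat = λ {_} {x′} {y} ps qs →
        gmap (_· y) (λ { (inj₁ p) → inj₁ (·-compat θ p (refl θ))
                       ; (inj₂ p) → inj₂ (·-compat φ p (refl φ)) }) ps
        ◅◅
        gmap (x′ ·_) (λ { (inj₁ q) → inj₁ (·-compat θ (refl θ) q)
                        ; (inj₂ q) → inj₂ (·-compat φ (refl φ) q) }) qs
    ; α-compat = gmap α (λ { (inj₁ p) → inj₁ (α-compat θ p)
                           ; (inj₂ q) → inj₂ (α-compat φ q) })
    }
    where R = rel θ ∪ rel φ

-- Congruences at any level at or above c ⊔ ℓ are closed under joins and
-- include _≈_ itself; every congruence can be lifted to such a level.
module _ {c ℓ} (k : Level) (A : RawAlgebra c ℓ) where
  open Congruence

  Con : Set (suc (c ⊔ ℓ ⊔ k))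
  Con = Congruence A (c ⊔ ℓ ⊔ k)

  congruenceLattice : Lattice (suc (c ⊔ ℓ ⊔ k)) (c ⊔ ℓ ⊔ k) (c ⊔ ℓ ⊔ k)
  congruenceLattice = record
    { Carrier   = Con
    ; _≈_       = λ θ φ → rel θ ⇔ rel φ
    ; _≤_       = λ θ φ → rel θ ⇒ rel φ
    ; _∨_       = _∨_
    ; _∧_       = _∧_
    ; isLattice = record
      { isPartialOrder = record
        { isPreorder = record
          { isEquivalence = record
            { refl  = id , id
            ; sym   = λ (f , g) → g , f
            ; trans = λ (f , g) (f′ , g′) → (λ p → f′ (f p)) , (λ p → g (g′ p))
            }
          ; reflexive = proj₁
          ; trans     = λ f g p → g (f p)
          }
        ; antisym = λ f g → f , g
        }
      ; supremum = λ θ φ →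
            (λ p → inj₁ p ◅ ε)
          , (λ q → inj₂ q ◅ ε)
          , λ ψ f g → fold (rel ψ)
              (λ { (inj₁ p) → trans ψ (f p) ; (inj₂ q) → trans ψ (g q) })
              (refl ψ)
      ; infimum = λ θ φ → proj₁ , proj₂ , λ ψ f g p → f p , g p
      }
    }

  CongruencePermutable : Set (suc (c ⊔ ℓ ⊔ k))
  CongruencePermutable = (θ φ : Con) → (rel θ ; rel φ) ⇔ (rel φ ; rel θ)

  CongruenceDistributive : Set (suc (c ⊔ ℓ ⊔ k))
  CongruenceDistributive =
    IsDistributiveLattice L._≈_ L._≤_ L._∨_ L._∧_
    where module L = Lattice congruenceLattice

  Arithmetical : Set (suc (c ⊔ ℓ ⊔ k))
  Arithmetical = CongruencePermutable × CongruenceDistributive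

module _ {c ℓ v} (V : RawAlgebra c ℓ → Set v) where

  IsArithmeticalClass : (k : Level) → Set (v ⊔ suc (c ⊔ ℓ ⊔ k))
  IsArithmeticalClass k = ∀ A → V A → Arithmetical k A

  IsMal'cevTerm : Term 3 → Set (v ⊔ suc (c ⊔ ℓ))
  IsMal'cevTerm t = ∀ A → V A → let open RawAlgebra A in
    ∀ x y → eval A t (x ∷ x ∷ y ∷ []) ≈ y
          × eval A t (x ∷ y ∷ y ∷ []) ≈ x

p : Term 3
p = αᵗ ((αᵗ (x ·ᵗ αᵗ y) ·ᵗ αᵗ z) +ᵗ (αᵗ (z ·ᵗ αᵗ y) ·ᵗ αᵗ x))
  where
  x y z : Term 3
  x = var 0F
  y = var 1F
  z = var 2F

{-# OPTIONS --safe #-}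

-- Łukasiewicz' identity says that D x y = α (x · α y) · α y is symmetric. It
-- forces α 1 = 0, so that 1 is the top element, and x · α x = 0; consequently
-- D x y is a lower bound of α x and α y, with D x x = α x. The Mal'cev
-- identities for p follow by absorption, and so do the majority identities for
-- α (D x y + D y z + D z x). A Mal'cev term yields permutability. A majority
-- term M yields distributivity: for a θ b, applying M(a, –, b) to a path from
-- a to b gives a path from a to b inside one θ-class.
module Submission where

open import Defs
open import Level using (Level; _⊔_)
open import Algebra.Structures using (IsCommutativeMonoid)
open import Data.Fin.Patterns using (0F; 1F; 2F)
open import Data.Product.Base using (_×_; _,_; proj₁; proj₂)
open import Data.Sum.Base using (inj₁; inj₂)
open import Data.Vec.Functional using (Vector; []; _∷_)
open import Relation.Binary.Construct.Composition using (_;_)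
open import Relation.Binary.Core using (_⇒_)
open import Relation.Binary.Construct.Closure.ReflexiveTransitive
  using (ε; _◅_; gmap)
open import Relation.Binary.Lattice.Bundles using (Lattice)
import Relation.Binary.Reasoning.Setoid as ≈-Reasoning

module _ {c ℓ k} {A : RawAlgebra c ℓ} (θ : Congruence A k) where
  open RawAlgebra A
  open Congruence θ

  eval-compat : ∀ {n} (t : Term n) {ρ σ : Vector Carrier n} →
                (∀ i → rel (ρ i) (σ i)) → rel (eval A t ρ) (eval A t σ)
  eval-compat (var i)  r = r i
  eval-compat (s +ᵗ t) r = +-compat (eval-compat s r) (eval-compat t r)
  eval-compat (s ·ᵗ t) r = ·-compat (eval-compat s r) (eval-compat t r)
  eval-compat (αᵗ t)   r = α-compat (eval-compat t r)
  eval-compat 0ᵗ       r = refl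
  eval-compat 1ᵗ       r = refl

  eval-compat₃ : (t : Term 3) {x x′ y y′ z z′ : Carrier} →
                 rel x x′ → rel y y′ → rel z z′ →
                 rel (eval A t (x ∷ y ∷ z ∷ [])) (eval A t (x′ ∷ y′ ∷ z′ ∷ []))
  eval-compat₃ t r s u = eval-compat t λ { 0F → r ; 1F → s ; 2F → u }

module _ {c ℓ} (A : RawAlgebra c ℓ) where
  open RawAlgebra A

  IsMal'cevTermOn : Term 3 → Set (c ⊔ ℓ)
  IsMal'cevTermOn t = ∀ x y → eval A t (x ∷ x ∷ y ∷ []) ≈ y
                            × eval A t (x ∷ y ∷ y ∷ []) ≈ x

  IsMajorityTermOn : Term 3 → Set (c ⊔ ℓ)
  IsMajorityTermOn t = ∀ x y → eval A t (x ∷ x ∷ y ∷ []) ≈ x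
                             × eval A t (x ∷ y ∷ x ∷ []) ≈ x
                             × eval A t (x ∷ y ∷ y ∷ []) ≈ y

module _ {c ℓ} (k : Level) {A : RawAlgebra c ℓ} (t : Term 3) where
  open Congruence

  mal'cev⇒permutable : IsMal'cevTermOn A t → CongruencePermutable k A
  mal'cev⇒permutable mal'cev θ φ = swap θ φ , swap φ θ
    where
    swap : (θ φ : Con k A) → (rel θ ; rel φ) ⇒ (rel φ ; rel θ)
    swap θ φ {x} {z} (y , xθy , yφz) =
        -- The midpoint: x = t(x,y,y) φ t(x,y,z) θ t(y,y,z) = z.
        eval A t (x ∷ y ∷ z ∷ [])
      , trans φ (sym φ (from-≈ φ (proj₂ (mal'cev x y))))
                (eval-compat₃ φ t (refl φ) (refl φ) yφz)
      , trans θ (eval-compat₃ θ t xθy (refl θ) (refl θ))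
                (from-≈ θ (proj₁ (mal'cev y z)))

  majority⇒distributive : IsMajorityTermOn A t → CongruenceDistributive k A
  majority⇒distributive majority = record
    { isLattice    = Lattice.isLattice (congruenceLattice k A)
    ; ∧-distribˡ-∨ = λ θ φ ψ → distrib θ φ ψ , codistrib θ φ ψ
    }
    where
    module L = Lattice (congruenceLattice k A)

    distrib : ∀ θ φ ψ → (θ ∧ (φ ∨ ψ)) L.≤ (θ ∧ φ ∨ θ ∧ ψ)
    distrib θ φ ψ {a} {b} (aθb , path) =
      -- The image path runs from `M a` to `M b`, which the first and third majority laws identify
      -- with `a` and `b`.
      trans χ (sym χ (from-≈ χ (proj₁ (majority a b))))
        (trans χ (gmap M (λ { (inj₁ p) → inj₁ (M-θ , M-compat φ p)
                            ; (inj₂ q) → inj₂ (M-θ , M-compat ψ q) }) path)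
          (from-≈ χ (proj₂ (proj₂ (majority a b)))))
      where
      χ : Con k A
      χ = θ ∧ φ ∨ θ ∧ ψ

      M : RawAlgebra.Carrier A → RawAlgebra.Carrier A
      M c = eval A t (a ∷ c ∷ b ∷ [])

      M-compat : (ω : Con k A) → ∀ {c d} → rel ω c d → rel ω (M c) (M d)
      M-compat ω r = eval-compat₃ ω t (refl ω) r (refl ω)

      -- Replacing the third argument `b` by `a` leaves t(a,c,a) = a, so all values of `M` share the
      -- θ-class of `a`.
      M-θ-a : ∀ c → rel θ (M c) a
      M-θ-a c = trans θ (eval-compat₃ θ t (refl θ) (refl θ) (sym θ aθb))
                        (from-≈ θ (proj₁ (proj₂ (majority a c))))

      M-θ : ∀ {c d} → rel θ (M c) (M d)
      M-θ {c} {d} = trans θ (M-θ-a c) (sym θ (M-θ-a d))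

    codistrib : ∀ θ φ ψ → (θ ∧ φ ∨ θ ∧ ψ) L.≤ (θ ∧ (φ ∨ ψ))
    codistrib θ φ ψ = L.∨-least {θ ∧ φ} {θ ∧ ψ} {θ ∧ (φ ∨ ψ)}
      (λ (r , p) → r , inj₁ p ◅ ε) (λ (r , q) → r , inj₂ q ◅ ε)

-- In an MV-algebra with `+` as join this is the meet of the complements, and `majorityᵗ` is then
-- the lattice median.
Dᵗ : ∀ {n} → Term n → Term n → Term n
Dᵗ s t = αᵗ (s ·ᵗ αᵗ t) ·ᵗ αᵗ t

majorityᵗ : Term 3
majorityᵗ = αᵗ (Dᵗ x y +ᵗ Dᵗ y z +ᵗ Dᵗ z x)
  where
  x y z : Term 3
  x = var 0F
  y = var 1F
  z = var 2F

module _ {c ℓ} {A : RawAlgebra c ℓ} (isŁNS : IsŁukasiewiczNearSemiring A) where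
  open RawAlgebra A
  open IsŁukasiewiczNearSemiring isŁNS
  open IsCommutativeMonoid +-isCommutativeMonoid
    using (setoid; refl; sym; trans)
    renaming (∙-cong to +-cong; ∙-congˡ to +-congˡ; ∙-congʳ to +-congʳ;
              assoc to +-assoc; comm to +-comm; identityˡ to +-identityˡ;
              identityʳ to +-identityʳ)
  open ≈-Reasoning setoid

  ·-congˡ : ∀ {x y z} → y ≈ z → x · y ≈ x · z
  ·-congˡ = ·-cong refl

  ·-congʳ : ∀ {x y z} → y ≈ z → y · x ≈ z · x
  ·-congʳ y≈z = ·-cong y≈z refl

  -- Since 0 lies below `α x`, antitonicity and involution apply.
  ≤α0 : ∀ x → x ≤ α 0#
  ≤α0 x = begin
    x + α 0#        ≈⟨ +-congʳ (α-involutive x) ⟨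
    α (α x) + α 0#  ≈⟨ α-antitone (+-identityˡ (α x)) ⟩
    α 0#            ∎

  -- Łukasiewicz' identity at (0, 1).
  α0·α1≈0 : α 0# · α 1# ≈ 0#
  α0·α1≈0 = begin
    α 0# · α 1#           ≈⟨ ·-congʳ (α-cong (proj₁ zero (α 1#))) ⟨
    α (0# · α 1#) · α 1#  ≈⟨ łukasiewicz 0# 1# ⟩
    α (1# · α 0#) · α 0#  ≈⟨ ·-congʳ (α-cong (proj₁ ·-identity (α 0#))) ⟩
    α (α 0#) · α 0#       ≈⟨ ·-congʳ (α-involutive 0#) ⟩
    0# · α 0#             ≈⟨ proj₁ zero (α 0#) ⟩
    0#                    ∎

  -- Right distributivity makes right multiplication monotone, so 1 ≤ α 0 yields α 1 ≤ α 0 · α 1 =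
  -- 0.
  α1≈0 : α 1# ≈ 0#
  α1≈0 = begin
    α 1#                     ≈⟨ +-identityʳ (α 1#) ⟨
    α 1# + 0#                ≈⟨ +-cong (proj₁ ·-identity (α 1#)) α0·α1≈0 ⟨
    1# · α 1# + α 0# · α 1#  ≈⟨ distribʳ (α 1#) 1# (α 0#) ⟨
    (1# + α 0#) · α 1#       ≈⟨ ·-congʳ (≤α0 1#) ⟩
    α 0# · α 1#              ≈⟨ α0·α1≈0 ⟩
    0#                       ∎

  α0≈1 : α 0# ≈ 1#
  α0≈1 = trans (α-cong (sym α1≈0)) (α-involutive 1#)

  ≤1 : ∀ x → x ≤ 1#
  ≤1 x = trans (+-congˡ (sym α0≈1)) (trans (≤α0 x) α0≈1)

  ·-lowerʳ : ∀ x y → x · y ≤ y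
  ·-lowerʳ x y = begin
    x · y + y       ≈⟨ +-congˡ (proj₁ ·-identity y) ⟨
    x · y + 1# · y  ≈⟨ distribʳ y x 1# ⟨
    (x + 1#) · y    ≈⟨ ·-congʳ (≤1 x) ⟩
    1# · y          ≈⟨ proj₁ ·-identity y ⟩
    y               ∎

  -- Łukasiewicz' identity at (x, 1): one side has the factor α 1 = 0.
  x·αx≈0 : ∀ x → x · α x ≈ 0#
  x·αx≈0 x = begin
    x · α x               ≈⟨ ·-congʳ (α-involutive x) ⟨
    α (α x) · α x         ≈⟨ ·-congʳ (α-cong (proj₁ ·-identity (α x))) ⟨
    α (1# · α x) · α x    ≈⟨ łukasiewicz x 1# ⟨
    α (x · α 1#) · α 1#   ≈⟨ ·-congˡ α1≈0 ⟩
    α (x · α 1#) · 0#     ≈⟨ proj₂ zero _ ⟩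
    0#                    ∎

  α[x·αx]·y≈y : ∀ x y → α (x · α x) · y ≈ y
  α[x·αx]·y≈y x y = begin
    α (x · α x) · y  ≈⟨ ·-congʳ (α-cong (x·αx≈0 x)) ⟩
    α 0# · y         ≈⟨ ·-congʳ α0≈1 ⟩
    1# · y           ≈⟨ proj₁ ·-identity y ⟩
    y                ∎

  D : Carrier → Carrier → Carrier
  D x y = α (x · α y) · α y

  D-idem : ∀ x → D x x ≈ α x
  D-idem x = α[x·αx]·y≈y x (α x)

  D-lowerʳ : ∀ x y → D x y ≤ α y
  D-lowerʳ x y = ·-lowerʳ (α (x · α y)) (α y)

  -- The right factor of `D x y` is only `α y`; symmetry of `D` exchanges the two bounds.
  D-lowerˡ : ∀ x y → D x y ≤ α x
  D-lowerˡ x y = trans (+-congʳ (łukasiewicz x y)) (D-lowerʳ y x)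

  absorbʳ : ∀ {x y z} → x ≈ z → y ≤ z → x + y ≈ z
  absorbʳ {x} {y} x≈z y≤z = trans (+-comm x y) (trans (+-congˡ x≈z) y≤z)

  absorbˡ : ∀ {x y z} → x ≤ z → y ≈ z → x + y ≈ z
  absorbˡ x≤z y≈z = trans (+-congˡ y≈z) x≤z

  α-flip : ∀ {x y} → x ≈ α y → α x ≈ y
  α-flip {y = y} x≈αy = trans (α-cong x≈αy) (α-involutive y)

  p-mal'cev : IsMal'cevTermOn A p
  p-mal'cev x y =
      -- Under the outer `α`, one summand equals the complement of the wanted value; the other is
      -- `D y x`, or `D x y` in the second law, and lies below it.
      α-flip (absorbʳ (α[x·αx]·y≈y x (α y)) (D-lowerˡ y x))
    , α-flip (absorbˡ (D-lowerˡ x y) (α[x·αx]·y≈y y (α x)))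

  majorityᵗ-majority : IsMajorityTermOn A majorityᵗ
  majorityᵗ-majority x y =
      -- In each law the repeated argument gives one summand `D x x` or `D y y`, which absorbs the
      -- two mixed ones.
      α-flip (absorbʳ (absorbʳ (D-idem x) (D-lowerˡ x y)) (D-lowerʳ y x))
    , α-flip (absorbˡ (+-≤ (D-lowerˡ x y) (D-lowerʳ y x)) (D-idem x))
    , α-flip (absorbʳ (absorbˡ (D-lowerʳ x y) (D-idem y)) (D-lowerˡ y x))
    where
    +-≤ : ∀ {a b z} → a ≤ z → b ≤ z → a + b ≤ z
    +-≤ {a} {b} {z} a≤z b≤z = trans (+-assoc a b z) (trans (+-congˡ b≤z) a≤z)

theorem8 : ∀ {c ℓ} (k : Level) → IsArithmeticalClass {c} {ℓ} IsŁukasiewiczNearSemiring k × IsMal'cevTerm {c} {ℓ} IsŁukasiewiczNearSemiring p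
theorem8 k =
    (λ A isŁNS → mal'cev⇒permutable k p (p-mal'cev isŁNS)
               , majority⇒distributive k majorityᵗ (majorityᵗ-majority isŁNS))
  , λ A isŁNS → p-mal'cev isŁNS
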